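{- Let $\lambda_1$ and $\lambda_2$ be two computons. Then there is a span $\rho$ of computon morphisms from a common apex computon to $\lambda_1$ (left leg) and $\lambda_2$ (right leg) whose pushout is a partial sequential computon $\lambda_1 \rhd_\rho \lambda_2$ or a total sequential computon $\lambda_1 \unrhd_\rho \lambda_2$ if and only if $\lambda_1$ and $\lambda_2$ are both connected computons.
   Context: $\mathbf{Set}$ is the category of finite sets and total functions. A computon $\lambda$ is a tuple $(U,P,I,O,\Sigma,\sigma,\tau,t,s,c)$ (a functor into $\mathbf{Set}$ from the free category on the arrows $\sigma:O\to U$, $\tau:I\to U$, $t:O\to P$, $s:I\to P$, $c:P\to\Sigma$) where $U$ (computation units), $I$ and $O$ (edges) are possibly empty finite sets, $P$ (ports) is a non-empty finite set, $\Sigma\subset\mathbb{N}$ (colours) is finite with $0\in\Sigma$, the functions $\sigma,\tau,c$ are surjective, and: the restrictions $\sigma|_{(c\circ t)^{ -1}(0)}$ and $\tau|_{(c\circ s)^{ -1}(0)}$ are surjective onto $U$; there is $p\in P\setminus \mathrm{Im}(s)$ with $c(p)=0$; there is $q\in P\setminus \mathrm{Im}(t)$ with $c(q)=0$. Components of $\lambda_j$ carry the subscript $j$. Put $P^+=P\setminus \mathrm{Im}(t)$ (e-inports) and $P^-=P\setminus \mathrm{Im}(s)$ (e-outports). Write $p\xrightarrow{i}u$ if $s(i)=p,\ \tau(i)=u$, and $u\xrightarrow{o}p$ if $\sigma(o)=u,\ t(o)=p$. For a port $p$, $\bullet p=\{u\in U\mid \exists o\in O,\ u\xrightarrow{o}p\}$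 and $p\bullet=\{u\in U\mid\exists i\in I,\ p\xrightarrow{i}u\}$. Write $p_1\xrightarrow{\exists}p_n$ if there is a chain $p_1\xrightarrow{i_1}u_1\xrightarrow{o_1}p_2\cdots\xrightarrow{i_{n-1}}u_{n-1}\xrightarrow{o_{n-1}}p_n$ with $n\ge 2$. A computon is connected if for each $p\in \mathrm{Im}(s)\cup P^+$ there is $q\in P^-$ with $p\xrightarrow{\exists}q$. A computon morphism $\alpha:\lambda_1\to\lambda_2$ is a natural transformation (functions $\alpha_U,\alpha_P,\alpha_I,\alpha_O,\alpha_\Sigma$ commuting with $\sigma,\tau,t,s,c$) such that $\alpha_\Sigma$ is the inclusion $\Sigma_1\subseteq\Sigma_2$ and $\vec{i}(\alpha)\cup\vec{o}(\alpha)\subseteq P_1^+\cup P_1^-$, where $\vec{i}(\alpha)=\{p\in P_1\mid \bullet\alpha(p)\setminus\alpha(\bullet p)\ne\emptyset\}$ and $\vec{o}(\alpha)=\{p\in P_1\mid \alpha(p)\bullet\setminus\alpha(p\bullet)\neq\emptyset\}$. Here $\alpha(p)=\alpha_P(p)$ and $\alpha(A)$ is the image of a set $A$ of ports or units. Computons and computon morphisms form the category $\mathbf{Set}^{\mathbf{Comp}}$ (componentwise composition). Pushout: the pushout of a span $\lambda_1\xleftarrow{\alpha_1}\lambda_0\xrightarrow{\alpha_2}\lambda_2$ is the computon obtained by computing the pushout in $\mathbf{Set}$ of each component ($X_3=X_1+_{X_0}X_2$ for $X\in\{P,U,I,O\}$), with $\Sigma_3=\Sigma_1\cup\Sigma_2$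 and the induced structure functions. A trivial computon is one with $U=I=O=\emptyset$. A span $\lambda_1\xleftarrow{\alpha_1}\lambda_0\xrightarrow{\alpha_2}\lambda_2$ of computon morphisms is sequentiable if (i) $\lambda_0$ is a trivial computon with $P_0=\vec{i}(\alpha_1)\cap\vec{o}(\alpha_2)$, (ii) $\lambda_1,\lambda_2$ are connected, (iii) $\alpha_1(\vec{o}(\alpha_2))\subseteq P_1^-$, and (iv) $\alpha_2(\vec{i}(\alpha_1))\subseteq P_2^+$. It is totally sequentiable if equality holds in both (iii) and (iv), and partially sequentiable if at least one of the two inclusions is proper. The pushout of a partially sequentiable span $\rho$ is called a partial sequential computon, written $\lambda_1\rhd_\rho\lambda_2$; the pushout of a totally sequentiable span $\rho$ is called a total sequential computon, written $\lambda_1\unrhd_\rho\lambda_2$. -}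

module Defs where

open import Level using (0ℓ)
open import Data.Fin.Base using (Fin)
open import Data.List.Base using (List)
open import Data.List.Membership.Propositional using () renaming (_∈_ to _∈ₗ_)
open import Data.Nat.Base using (ℕ)
open import Data.Product.Base using (∃; _×_)
open import Data.Sum.Base using (_⊎_)
open import Function.Base using (_∘_)
open import Function.Bundles using (_↔_; _⇔_)
open import Function.Definitions using (StrictlySurjective)
open import Relation.Binary.Construct.Closure.Transitive using (TransClosure)
open import Relation.Binary.PropositionalEquality using (_≡_; _≗_)
open import Relation.Nullary.Negation using (¬_)
open import Relation.Unary
  using (Pred; _∈_; _∉_; _⊆_; _⊂_; _≐_; _∪_; _∩_; _∖_; ∁; Satisfiable; Universal)

Finite : Set → Set
Finite A = ∃ λ n → A ↔ Fin n

FiniteSubset : Pred ℕ 0ℓ → Set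
FiniteSubset A = ∃ λ (xs : List ℕ) → ∀ n → n ∈ A ⇔ n ∈ₗ xs

Im : ∀ {A B : Set} → (A → B) → Pred B 0ℓ
Im f y = ∃ λ x → f x ≡ y

Image : ∀ {A B : Set} → (A → B) → Pred A 0ℓ → Pred B 0ℓ
Image f A y = ∃ λ x → x ∈ A × f x ≡ y

-- The set of colours Σ is a subset of ℕ, so the colouring P → Σ is given as a
-- map c into ℕ together with c∈Σ, and its surjectivity is onto Σ, not onto ℕ.
record Computon : Set₁ where
  field
    U P I O  : Set
    U-finite : Finite U
    P-finite : Finite P
    I-finite : Finite I
    O-finite : Finite O
    P-nonempty : P

    Σ        : Pred ℕ 0ℓ
    Σ-finite : FiniteSubset Σ
    0∈Σ      : 0 ∈ Σ

    σ : O → U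
    τ : I → U
    t : O → P
    s : I → P
    c : P → ℕ
    c∈Σ : ∀ p → c p ∈ Σ

    σ-surjective : StrictlySurjective _≡_ σ
    τ-surjective : StrictlySurjective _≡_ τ
    c-surjective : ∀ n → n ∈ Σ → ∃ λ p → c p ≡ n

    σ₀-surjective : ∀ u → ∃ λ o → c (t o) ≡ 0 × σ o ≡ u
    τ₀-surjective : ∀ u → ∃ λ i → c (s i) ≡ 0 × τ i ≡ u

    ∃-outport₀ : ∃ λ p → p ∉ Im s × c p ≡ 0
    ∃-inport₀  : ∃ λ q → q ∉ Im t × c q ≡ 0

open Computon

infix 20 _⁺ _⁻

_⁺ _⁻ : (Λ : Computon) → Pred (P Λ) 0ℓ
Λ ⁺ = ∁ (Im (t Λ))
Λ ⁻ = ∁ (Im (s Λ))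

•[_]_ : (Λ : Computon) → P Λ → Pred (U Λ) 0ℓ
(•[ Λ ] p) u = ∃ λ o → σ Λ o ≡ u × t Λ o ≡ p

[_]_• : (Λ : Computon) → P Λ → Pred (U Λ) 0ℓ
([ Λ ] p •) u = ∃ λ i → s Λ i ≡ p × τ Λ i ≡ u

Step : (Λ : Computon) → P Λ → P Λ → Set
Step Λ p q = ∃ λ u → u ∈ ([ Λ ] p •) × u ∈ (•[ Λ ] q)

-- The chains have n ≥ 2 ports, hence at least one step.
Reaches : (Λ : Computon) → P Λ → P Λ → Set
Reaches Λ = TransClosure (Step Λ)

Connected : Computon → Set
Connected Λ = ∀ p → p ∈ Im (s Λ) ∪ Λ ⁺ → ∃ λ q → q ∈ Λ ⁻ × Reaches Λ p q

Trivial : Computon → Set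
Trivial Λ = ¬ U Λ × ¬ I Λ × ¬ O Λ

-- Natural transformations whose component at Σ is the inclusion; naturality at
-- c then says that colours, as elements of ℕ, are preserved.
record Transformation (Λ₁ Λ₂ : Computon) : Set where
  field
    fU  : U Λ₁ → U Λ₂
    fP  : P Λ₁ → P Λ₂
    fI  : I Λ₁ → I Λ₂
    fO  : O Λ₁ → O Λ₂
    Σ⊆Σ : Σ Λ₁ ⊆ Σ Λ₂
    natural-σ : fU ∘ σ Λ₁ ≗ σ Λ₂ ∘ fO
    natural-τ : fU ∘ τ Λ₁ ≗ τ Λ₂ ∘ fI
    natural-t : fP ∘ t Λ₁ ≗ t Λ₂ ∘ fO
    natural-s : fP ∘ s Λ₁ ≗ s Λ₂ ∘ fI
    natural-c : c Λ₁ ≗ c Λ₂ ∘ fP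

  i⃗ o⃗ : Pred (P Λ₁) 0ℓ
  i⃗ p = Satisfiable ((•[ Λ₂ ] fP p) ∖ Image fU (•[ Λ₁ ] p))
  o⃗ p = Satisfiable (([ Λ₂ ] fP p •) ∖ Image fU ([ Λ₁ ] p •))

record Morphism (Λ₁ Λ₂ : Computon) : Set where
  field
    transformation : Transformation Λ₁ Λ₂
  open Transformation transformation public
  field
    i⃗∪o⃗⊆ : i⃗ ∪ o⃗ ⊆ Λ₁ ⁺ ∪ Λ₁ ⁻

open Morphism using (fP; i⃗; o⃗)

record Span (Λ₁ Λ₂ : Computon) : Set₁ where
  field
    apex : Computon
    α₁   : Morphism apex Λ₁
    α₂   : Morphism apex Λ₂

-- Pushout squares in the category of finite sets.
record IsPushout {X₀ X₁ X₂ X₃ : Set}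
                 (f₁ : X₀ → X₁) (f₂ : X₀ → X₂)
                 (g₁ : X₁ → X₃) (g₂ : X₂ → X₃) : Set₁ where
  field
    commutes  : g₁ ∘ f₁ ≗ g₂ ∘ f₂
    universal : ∀ {Y : Set} → Finite Y →
                (h₁ : X₁ → Y) (h₂ : X₂ → Y) → h₁ ∘ f₁ ≗ h₂ ∘ f₂ →
                ∃ λ (k : X₃ → Y) → (k ∘ g₁ ≗ h₁ × k ∘ g₂ ≗ h₂) ×
                  (∀ (k′ : X₃ → Y) → k′ ∘ g₁ ≗ h₁ → k′ ∘ g₂ ≗ h₂ → k′ ≗ k)

-- Naturality of β₁ and β₂ says that the structure functions of Λ₃ are the ones
-- induced on the componentwise pushouts.
record PushoutOf {Λ₁ Λ₂ : Computon} (ρ : Span Λ₁ Λ₂) (Λ₃ : Computon) : Set₁ where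
  open Span ρ
  field
    β₁ : Transformation Λ₁ Λ₃
    β₂ : Transformation Λ₂ Λ₃
  private
    module A₁ = Morphism α₁
    module A₂ = Morphism α₂
    module B₁ = Transformation β₁
    module B₂ = Transformation β₂
  field
    U-pushout : IsPushout A₁.fU A₂.fU B₁.fU B₂.fU
    P-pushout : IsPushout A₁.fP A₂.fP B₁.fP B₂.fP
    I-pushout : IsPushout A₁.fI A₂.fI B₁.fI B₂.fI
    O-pushout : IsPushout A₁.fO A₂.fO B₁.fO B₂.fO
    Σ-union   : Σ Λ₃ ≐ Σ Λ₁ ∪ Σ Λ₂

module _ {Λ₁ Λ₂ : Computon} (ρ : Span Λ₁ Λ₂) where
  open Span ρ

  record Sequentiable : Set where
    field
      apex-trivial : Trivial apex
      apex-ports   : Universal (i⃗ α₁ ∩ o⃗ α₂)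
      connected₁   : Connected Λ₁
      connected₂   : Connected Λ₂
      ⊆-outports   : Image (fP α₁) (o⃗ α₂) ⊆ Λ₁ ⁻
      ⊆-inports    : Image (fP α₂) (i⃗ α₁) ⊆ Λ₂ ⁺

  TotallySequentiable : Set
  TotallySequentiable = Sequentiable
    × Image (fP α₁) (o⃗ α₂) ≐ Λ₁ ⁻
    × Image (fP α₂) (i⃗ α₁) ≐ Λ₂ ⁺

  PartiallySequentiable : Set
  PartiallySequentiable = Sequentiable
    × (Image (fP α₁) (o⃗ α₂) ⊂ Λ₁ ⁻ ⊎ Image (fP α₂) (i⃗ α₁) ⊂ Λ₂ ⁺)

  PartialSequentialComputon : Computon → Set₁
  PartialSequentialComputon Λ₃ = PartiallySequentiable × PushoutOf ρ Λ₃

  TotalSequentialComputon : Computon → Set₁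
  TotalSequentialComputon Λ₃ = TotallySequentiable × PushoutOf ρ Λ₃

{-# OPTIONS --safe #-}
-- Connectedness of both operands is part of sequentiability. Conversely, glue a colour-0
-- e-outport p₁ of Λ₁ to a colour-0 e-inport p₂ of Λ₂ along the trivial computon with one port.
-- In a connected computon no port is isolated, so p₁ is the target of some o-edge and p₂ the
-- source of some i-edge; this makes the span sequentiable. It is total or partial according to
-- whether p₁ is the only e-outport of Λ₁ and p₂ the only e-inport of Λ₂, which is decidable
-- because all carriers are finite.
module Submission where

open import Defs
open import Data.Product.Base using (∃; _×_)
open import Data.Sum.Base using (_⊎_)
open import Function.Bundles using (_⇔_)

open import Data.Empty using (⊥)
open import Data.Fin.Base using (Fin; zero; suc)
open import Data.Fin.Permutation using (transpose)
open import Data.Fin.Properties using (0↔⊥; 1↔⊤; +↔⊎; any?; all?; inj⇒≟) renaming (_≟_ to _≟ᶠ_)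
open import Data.List.Base using ([_]; _++_)
open import Data.List.Membership.Propositional.Properties using (++-∈⇔)
open import Data.List.Relation.Unary.Any using (here; there)
open import Data.Nat.Base using (ℕ)
open import Data.Product.Base using (_,_; proj₁; proj₂)
open import Data.Sum.Base as Sum using (inj₁; inj₂)
open import Data.Sum.Function.Propositional using (_⊎-↔_; _⊎-⇔_)
open import Data.Sum.Properties using (inj₁-injective)
open import Data.Unit.Base using (⊤; tt)
open import Function.Base using (_∘_; const; id)
open import Function.Bundles using (_↔_; mk⇔; Inverse)
open import Function.Construct.Composition using (_↔-∘_; _⇔-∘_)
open import Function.Construct.Identity using (↔-id)
open import Function.Construct.Symmetry using (↔-sym; ⇔-sym)
open import Function.Properties.Inverse using (↔⇒↣)
open import Relation.Binary.Construct.Closure.Transitive using (_∷_) renaming ([_] to [_]⁺)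
open import Relation.Binary.Definitions using (DecidableEquality)
open import Relation.Binary.PropositionalEquality using (_≡_; _≗_; refl; sym; trans; cong; subst)
open import Relation.Nullary.Decidable using (Dec; yes; no; map′; ¬?; _→-dec_; dec-true; decidable-stable)
open import Relation.Unary using (Decidable; _∈_; _∉_; _⊆_; _∪_)

open Inverse using (to; from; strictlyInverseˡ; strictlyInverseʳ)

-- Finite sets: sums, decidable quantifiers, enumerations.

⊥-finite : Finite ⊥
⊥-finite = 0 , ↔-sym 0↔⊥

⊤-finite : Finite ⊤
⊤-finite = 1 , ↔-sym 1↔⊤

⊎-finite : ∀ {A B} → Finite A → Finite B → Finite (A ⊎ B)
⊎-finite (m , e) (n , f) = _ , (↔-sym +↔⊎ ↔-∘ (e ⊎-↔ f))

module _ {A : Set} (A-finite : Finite A) where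
  private e = proj₂ A-finite

  finite-≟ : DecidableEquality A
  finite-≟ = inj⇒≟ (↔⇒↣ e)

  finite-∃? : ∀ {Q : A → Set} → Decidable Q → Dec (∃ Q)
  finite-∃? {Q} Q? = map′ (λ (k , q) → from e k , q)
    (λ (a , q) → to e a , subst Q (sym (strictlyInverseʳ e a)) q) (any? (Q? ∘ from e))

  finite-∀? : ∀ {Q : A → Set} → Decidable Q → Dec (∀ a → Q a)
  finite-∀? {Q} Q? = map′ (λ q a → subst Q (strictlyInverseʳ e a) (q (to e a)))
    (λ q → q ∘ from e) (all? (Q? ∘ from e))

  -- Any enumeration can be followed by the transposition of `zero` with the index of `a`. With the
  -- base point at index `zero`, the remaining elements are `suc k`, so a wedge needs neither a
  -- quotient nor a subtype.
  pointed-enumeration : ∀ a → ∃ λ n → ∃ λ (φ : A ↔ Fin (ℕ.suc n)) → to φ a ≡ zero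
  pointed-enumeration a = swapped A-finite
    where
    swapped : Finite A → _
    swapped (ℕ.zero  , f) with () ← to f a
    swapped (ℕ.suc n , f) = n , (transpose (to f a) zero ↔-∘ f) , swap-to
      where
      swap-to : to (transpose (to f a) zero) (to f a) ≡ zero
      -- `transpose` tests its argument against `to f a`; the rewrite settles this test.
      swap-to rewrite dec-true (to f a ≟ᶠ to f a) refl = refl

Im? : ∀ {A B : Set} → Finite A → Finite B → (f : A → B) → Decidable (Im f)
Im? A-finite B-finite f y = finite-∃? A-finite (λ x → finite-≟ B-finite (f x) y)

∪-finite : ∀ {A B} → FiniteSubset A → FiniteSubset B → FiniteSubset (A ∪ B)
∪-finite (xs , A⇔) (ys , B⇔) = xs ++ ys , λ n → ⇔-sym ++-∈⇔ ⇔-∘ (A⇔ n ⊎-⇔ B⇔ n)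

-- Pushouts of sets over the empty set and over a point.

⊎-pushout : ∀ {A B : Set} {f₁ : ⊥ → A} {f₂ : ⊥ → B} → IsPushout f₁ f₂ inj₁ inj₂
⊎-pushout = record
  { commutes  = λ ()
  ; universal = λ _ h₁ h₂ _ → Sum.[ h₁ , h₂ ] , ((λ _ → refl) , (λ _ → refl)) ,
      λ _ k₁ k₂ → Sum.[ k₁ , k₂ ]
  }

-- The wedge of (A , a) and (B , b), with B ∖ {b} enumerated by Fin n.
module Wedge {A B : Set} {n : ℕ} (a : A) (b : B)
             (φ : B ↔ Fin (ℕ.suc n)) (φb≡0 : to φ b ≡ zero) where

  Carrier : Set
  Carrier = A ⊎ Fin n

  glue : Fin (ℕ.suc n) → Carrier
  glue zero    = inj₁ a
  glue (suc k) = inj₂ k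

  ι₁ : A → Carrier
  ι₁ = inj₁

  ι₂ : B → Carrier
  ι₂ = glue ∘ to φ

  from-zero : from φ zero ≡ b
  from-zero = trans (cong (from φ) (sym φb≡0)) (strictlyInverseʳ φ b)

  ι₂-suc : ∀ k → ι₂ (from φ (suc k)) ≡ inj₂ k
  ι₂-suc k = cong glue (strictlyInverseˡ φ (suc k))

  ι-commutes : ι₁ a ≡ ι₂ b
  ι-commutes = cong glue (sym φb≡0)

  module _ {Y : Set} (h₁ : A → Y) (h₂ : B → Y) where
    copair : Carrier → Y
    copair = Sum.[ h₁ , h₂ ∘ from φ ∘ suc ]

    copair-ι₂ : h₁ a ≡ h₂ b → copair ∘ ι₂ ≗ h₂
    copair-ι₂ eq y = trans (copair-glue (to φ y)) (cong h₂ (strictlyInverseʳ φ y))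
      where
      copair-glue : copair ∘ glue ≗ h₂ ∘ from φ
      -- At the wedge point `copair` takes its value from `h₁`, so `eq` is what brings it to `h₂ b`.
      copair-glue zero    = trans eq (cong h₂ (sym from-zero))
      copair-glue (suc _) = refl

  -- Collapsing all of `A` to `b` gives a left inverse of `ι₂`.
  ι₂-injective : ∀ {x y} → ι₂ x ≡ ι₂ y → x ≡ y
  ι₂-injective {x} {y} eq =
    trans (sym (retract x)) (trans (cong unglue eq) (retract y))
    where
    unglue : Carrier → B
    unglue = copair (const b) id
    retract : unglue ∘ ι₂ ≗ id
    retract = copair-ι₂ (const b) id refl

  -- `glue` reaches the left summand only at index `zero`, with value `inj₁ a`. So the two images
  -- meet only in the wedge point.
  ι₁≡ι₂⇒≡a : ∀ {x y} → ι₁ x ≡ ι₂ y → x ≡ a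
  ι₁≡ι₂⇒≡a {y = y} eq with to φ y
  ι₁≡ι₂⇒≡a refl | zero = refl

  ι₁≡ι₂⇒≡b : ∀ {x y} → ι₁ x ≡ ι₂ y → y ≡ b
  ι₁≡ι₂⇒≡b eq =
    -- The chain is `ι₂ b ≡ ι₁ a ≡ ι₁ x ≡ ι₂ y`.
    sym (ι₂-injective (trans (sym ι-commutes) (trans (cong ι₁ (sym (ι₁≡ι₂⇒≡a eq))) eq)))

  wedge-pushout : IsPushout {⊤} (const a) (const b) ι₁ ι₂
  wedge-pushout = record
    { commutes  = λ _ → ι-commutes
    ; universal = λ _ h₁ h₂ eq →
        copair h₁ h₂ , ((λ _ → refl) , copair-ι₂ h₁ h₂ (eq tt)) , λ k k₁ k₂ →
          λ { (inj₁ x) → k₁ x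
            -- Every element of the right summand is a value of `ι₂`, so `k₂` determines `k` there.
            ; (inj₂ j) → trans (cong k (sym (ι₂-suc j))) (k₂ (from φ (suc j))) }
    }

-- The one-port trivial computon and its morphisms.

point : Computon
point = record
  { U = ⊥ ; P = ⊤ ; I = ⊥ ; O = ⊥
  ; U-finite = ⊥-finite ; P-finite = ⊤-finite ; I-finite = ⊥-finite ; O-finite = ⊥-finite
  ; P-nonempty = tt
  -- Colour 0 occurs in every computon, so with this colour set a morphism to `Λ` amounts to a port
  -- of `Λ` of colour 0.
  ; Σ = _≡ 0
  ; Σ-finite = [ 0 ] , λ _ → mk⇔ here (λ { (here eq) → eq ; (there ()) })
  ; 0∈Σ = refl
  ; σ = λ () ; τ = λ () ; t = λ () ; s = λ ()
  ; c = const 0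
  ; c∈Σ = λ _ → refl
  ; σ-surjective = λ () ; τ-surjective = λ ()
  ; c-surjective = λ _ eq → tt , sym eq
  ; σ₀-surjective = λ () ; τ₀-surjective = λ ()
  ; ∃-outport₀ = tt , (λ ()) , refl
  ; ∃-inport₀  = tt , (λ ()) , refl
  }

open Computon

point-morphism : (Λ : Computon) (p : P Λ) → c Λ p ≡ 0 → Morphism point Λ
point-morphism Λ p cp≡0 = record
  { transformation = record
    { fU = λ () ; fP = const p ; fI = λ () ; fO = λ ()
    ; Σ⊆Σ = λ { refl → 0∈Σ Λ }
    ; natural-σ = λ () ; natural-τ = λ () ; natural-t = λ () ; natural-s = λ ()
    ; natural-c = λ _ → sym cp≡0
    }
  -- Without edges the port is an e-inport, whatever surrounds its image.
  ; i⃗∪o⃗⊆ = λ _ → inj₁ λ ()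
  }

-- Connected computons have no isolated ports.

Reaches-source : ∀ {Λ p q} → Reaches Λ p q → p ∈ Im (s Λ)
Reaches-source [ _ , (i , eq , _) , _ ]⁺   = i , eq
Reaches-source ((_ , (i , eq , _) , _) ∷ _) = i , eq

connected-inport : ∀ {Λ} → Connected Λ → Λ ⁺ ⊆ Im (s Λ)
connected-inport {Λ} connected p∈⁺ =
  Reaches-source {Λ} (proj₂ (proj₂ (connected _ (inj₂ p∈⁺))))

-- An e-outport outside `Im (t Λ)` would also be an e-inport, hence the source of an i-edge, a
-- contradiction. Finiteness makes `Im (t Λ)` decidable, which removes the double negation.
connected-outport : ∀ {Λ} → Connected Λ → Λ ⁻ ⊆ Im (t Λ)
connected-outport {Λ} connected p∈⁻ =
  decidable-stable (Im? (O-finite Λ) (P-finite Λ) (t Λ) _) (p∈⁻ ∘ connected-inport {Λ} connected)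

-- The one-port span and its pushout.

module _ (Λ₁ Λ₂ : Computon) {p₁ : P Λ₁} {p₂ : P Λ₂}
         (p₁-colour : c Λ₁ p₁ ≡ 0) (p₂-colour : c Λ₂ p₂ ≡ 0) where

  gluing-span : Span Λ₁ Λ₂
  gluing-span = record
    { apex = point
    ; α₁   = point-morphism Λ₁ p₁ p₁-colour
    ; α₂   = point-morphism Λ₂ p₂ p₂-colour
    }

  module _ (p₁∈Im-t : p₁ ∈ Im (t Λ₁)) (p₂∈Im-s : p₂ ∈ Im (s Λ₂)) where

    gluing-sequentiable : p₁ ∈ Λ₁ ⁻ → p₂ ∈ Λ₂ ⁺ → Connected Λ₁ → Connected Λ₂ →
                          Sequentiable gluing-span
    gluing-sequentiable p₁∈⁻ p₂∈⁺ connected₁ connected₂ = record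
      { apex-trivial = (λ ()) , (λ ()) , (λ ())
      -- The apex has no units, so any unit before `p₁` witnesses `i⃗` and any unit after `p₂`
      -- witnesses `o⃗`.
      ; apex-ports   = λ _ →
          (_ , (proj₁ p₁∈Im-t , refl , proj₂ p₁∈Im-t) , λ ()) ,
          (_ , (proj₁ p₂∈Im-s , proj₂ p₂∈Im-s , refl) , λ ())
      ; connected₁   = connected₁
      ; connected₂   = connected₂
      ; ⊆-outports   = λ { (_ , _ , refl) → p₁∈⁻ }
      ; ⊆-inports    = λ { (_ , _ , refl) → p₂∈⁺ }
      }

    gluing-partial-or-total : Sequentiable gluing-span →
      PartiallySequentiable gluing-span ⊎ TotallySequentiable gluing-span
    gluing-partial-or-total sequentiable
      -- The images under the legs are the singletons of `p₁` and `p₂`, so each equality is a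
      -- uniqueness statement.
      with finite-∀? (P-finite Λ₁) (λ p →
             ¬? (Im? (I-finite Λ₁) (P-finite Λ₁) (s Λ₁) p) →-dec finite-≟ (P-finite Λ₁) p₁ p)
         | finite-∀? (P-finite Λ₂) (λ p →
             ¬? (Im? (O-finite Λ₂) (P-finite Λ₂) (t Λ₂) p) →-dec finite-≟ (P-finite Λ₂) p₂ p)
    -- Properness in `⊂` is the negated reverse inclusion, so no second e-outport has to be
    -- exhibited.
    ... | no ¬unique | _ = inj₁ (sequentiable , inj₁ (⊆-outports , λ ⊇-outports →
            ¬unique λ _ p∈⁻ → proj₂ (proj₂ (⊇-outports p∈⁻))))
      where open Sequentiable sequentiable
    ... | yes _ | no ¬unique = inj₁ (sequentiable , inj₂ (⊆-inports , λ ⊇-inports →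
            ¬unique λ _ p∈⁺ → proj₂ (proj₂ (⊇-inports p∈⁺))))
      where open Sequentiable sequentiable
    ... | yes unique₁ | yes unique₂ = inj₂
          ( sequentiable
          , (⊆-outports , λ p∈⁻ → tt , proj₂ (apex-ports tt) , unique₁ _ p∈⁻)
          , (⊆-inports  , λ p∈⁺ → tt , proj₁ (apex-ports tt) , unique₂ _ p∈⁺))
      where open Sequentiable sequentiable

    private
      enumeration = pointed-enumeration (P-finite Λ₂) p₂
      module W = Wedge p₁ p₂ (proj₁ (proj₂ enumeration)) (proj₂ (proj₂ enumeration))

    wedge-colour : W.Carrier → ℕ
    wedge-colour = W.copair (c Λ₁) (c Λ₂)

    -- Both glued ports have colour 0, so the colourings agree at the wedge point.
    wedge-colour-ι₂ : wedge-colour ∘ W.ι₂ ≗ c Λ₂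
    wedge-colour-ι₂ = W.copair-ι₂ (c Λ₁) (c Λ₂) (trans p₁-colour (sym p₂-colour))

    wedge : Computon
    wedge = record
      { U = U Λ₁ ⊎ U Λ₂
      ; P = W.Carrier
      ; I = I Λ₁ ⊎ I Λ₂
      ; O = O Λ₁ ⊎ O Λ₂
      ; U-finite = ⊎-finite (U-finite Λ₁) (U-finite Λ₂)
      ; P-finite = ⊎-finite (P-finite Λ₁) (_ , ↔-id _)
      ; I-finite = ⊎-finite (I-finite Λ₁) (I-finite Λ₂)
      ; O-finite = ⊎-finite (O-finite Λ₁) (O-finite Λ₂)
      ; P-nonempty = W.ι₁ p₁
      ; Σ = Σ Λ₁ ∪ Σ Λ₂
      ; Σ-finite = ∪-finite (Σ-finite Λ₁) (Σ-finite Λ₂)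
      ; 0∈Σ = inj₁ (0∈Σ Λ₁)
      ; σ = Sum.map (σ Λ₁) (σ Λ₂)
      ; τ = Sum.map (τ Λ₁) (τ Λ₂)
      ; t = t₃
      ; s = s₃
      ; c = wedge-colour
      ; c∈Σ = λ { (inj₁ p) → inj₁ (c∈Σ Λ₁ p) ; (inj₂ _) → inj₂ (c∈Σ Λ₂ _) }
      ; σ-surjective = λ
          { (inj₁ u) → let (o , eq) = σ-surjective Λ₁ u in inj₁ o , cong inj₁ eq
          ; (inj₂ u) → let (o , eq) = σ-surjective Λ₂ u in inj₂ o , cong inj₂ eq }
      ; τ-surjective = λ
          { (inj₁ u) → let (i , eq) = τ-surjective Λ₁ u in inj₁ i , cong inj₁ eq
          ; (inj₂ u) → let (i , eq) = τ-surjective Λ₂ u in inj₂ i , cong inj₂ eq }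
      ; c-surjective = λ
          { n (inj₁ n∈) → let (p , eq) = c-surjective Λ₁ n n∈ in W.ι₁ p , eq
          ; n (inj₂ n∈) → let (p , eq) = c-surjective Λ₂ n n∈ in
                          W.ι₂ p , trans (wedge-colour-ι₂ p) eq }
      ; σ₀-surjective = λ
          { (inj₁ u) → let (o , c≡0 , eq) = σ₀-surjective Λ₁ u in
                       inj₁ o , c≡0 , cong inj₁ eq
          ; (inj₂ u) → let (o , c≡0 , eq) = σ₀-surjective Λ₂ u in
                       inj₂ o , trans (wedge-colour-ι₂ _) c≡0 , cong inj₂ eq }
      ; τ₀-surjective = λ
          { (inj₁ u) → let (i , c≡0 , eq) = τ₀-surjective Λ₁ u in
                       inj₁ i , c≡0 , cong inj₁ eq
          ; (inj₂ u) → let (i , c≡0 , eq) = τ₀-surjective Λ₂ u in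
                       inj₂ i , trans (wedge-colour-ι₂ _) c≡0 , cong inj₂ eq }
      ; ∃-outport₀ = let (q , q∈⁻ , c≡0) = ∃-outport₀ Λ₂ in
          W.ι₂ q , outport₃ q∈⁻ , trans (wedge-colour-ι₂ q) c≡0
      ; ∃-inport₀ = let (q , q∈⁺ , c≡0) = ∃-inport₀ Λ₁ in
          W.ι₁ q , inport₃ q∈⁺ , c≡0
      }
      where
      t₃ : O Λ₁ ⊎ O Λ₂ → W.Carrier
      t₃ = Sum.[ W.ι₁ ∘ t Λ₁ , W.ι₂ ∘ t Λ₂ ]

      s₃ : I Λ₁ ⊎ I Λ₂ → W.Carrier
      s₃ = Sum.[ W.ι₁ ∘ s Λ₁ , W.ι₂ ∘ s Λ₂ ]

      -- An i-edge of `Λ₁` starting at `ι₂ q` would force `q ≡ p₂`, but `p₂` is already the source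
      -- of an i-edge of `Λ₂`. Thus e-outports of `Λ₂` survive gluing.
      outport₃ : ∀ {q} → q ∈ Λ₂ ⁻ → W.ι₂ q ∉ Im s₃
      outport₃ q∈⁻ (inj₁ i , eq) = q∈⁻ (subst (Im (s Λ₂)) (sym (W.ι₁≡ι₂⇒≡b eq)) p₂∈Im-s)
      outport₃ q∈⁻ (inj₂ i , eq) = q∈⁻ (i , W.ι₂-injective eq)

      -- Dually, an o-edge of `Λ₂` can end in `ι₁ q` only if `q ≡ p₁`, and `p₁` is already the
      -- target of an o-edge of `Λ₁`.
      inport₃ : ∀ {q} → q ∈ Λ₁ ⁺ → W.ι₁ q ∉ Im t₃
      inport₃ q∈⁺ (inj₁ o , eq) = q∈⁺ (o , inj₁-injective eq)
      inport₃ q∈⁺ (inj₂ o , eq) = q∈⁺ (subst (Im (t Λ₁)) (sym (W.ι₁≡ι₂⇒≡a (sym eq))) p₁∈Im-t)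

    wedge-isPushout : PushoutOf gluing-span wedge
    wedge-isPushout = record
      { β₁ = record
        { fU = inj₁ ; fP = W.ι₁ ; fI = inj₁ ; fO = inj₁
        ; Σ⊆Σ = inj₁
        ; natural-σ = λ _ → refl ; natural-τ = λ _ → refl
        ; natural-t = λ _ → refl ; natural-s = λ _ → refl
        ; natural-c = λ _ → refl
        }
      ; β₂ = record
        { fU = inj₂ ; fP = W.ι₂ ; fI = inj₂ ; fO = inj₂
        ; Σ⊆Σ = inj₂
        ; natural-σ = λ _ → refl ; natural-τ = λ _ → refl
        ; natural-t = λ _ → refl ; natural-s = λ _ → refl
        ; natural-c = sym ∘ wedge-colour-ι₂
        }
      ; U-pushout = ⊎-pushout
      ; P-pushout = W.wedge-pushout
      ; I-pushout = ⊎-pushout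
      ; O-pushout = ⊎-pushout
      ; Σ-union   = id , id
      }

theorem1 : (Λ₁ Λ₂ : Computon) →
    (∃ λ (ρ : Span Λ₁ Λ₂) → ∃ λ (Λ₃ : Computon) →
    PartialSequentialComputon ρ Λ₃ ⊎ TotalSequentialComputon ρ Λ₃)
    ⇔ (Connected Λ₁ × Connected Λ₂)
theorem1 Λ₁ Λ₂ = mk⇔
  (λ { (_ , _ , inj₁ ((sequentiable , _) , _)) → connected sequentiable
     ; (_ , _ , inj₂ ((sequentiable , _) , _)) → connected sequentiable })
  glued
  where
  connected : ∀ {ρ} → Sequentiable ρ → Connected Λ₁ × Connected Λ₂
  connected sequentiable = connected₁ , connected₂
    where open Sequentiable sequentiable

  glued : Connected Λ₁ × Connected Λ₂ → _
  glued (connected₁ , connected₂) =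
    let (_ , p₁∈⁻ , c₁≡0) = ∃-outport₀ Λ₁
        (_ , p₂∈⁺ , c₂≡0) = ∃-inport₀ Λ₂
        p₁∈Im-t = connected-outport {Λ₁} connected₁ p₁∈⁻
        p₂∈Im-s = connected-inport {Λ₂} connected₂ p₂∈⁺
        sequentiable = gluing-sequentiable Λ₁ Λ₂ c₁≡0 c₂≡0 p₁∈Im-t p₂∈Im-s
                         p₁∈⁻ p₂∈⁺ connected₁ connected₂
        pushout = wedge-isPushout Λ₁ Λ₂ c₁≡0 c₂≡0 p₁∈Im-t p₂∈Im-s
    in gluing-span Λ₁ Λ₂ c₁≡0 c₂≡0 , wedge Λ₁ Λ₂ c₁≡0 c₂≡0 p₁∈Im-t p₂∈Im-s ,
       -- The same pushout serves the partial and the total case.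
       Sum.map (_, pushout) (_, pushout)
         (gluing-partial-or-total Λ₁ Λ₂ c₁≡0 c₂≡0 p₁∈Im-t p₂∈Im-s sequentiable)
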